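{- Let $k\ge3$ and $m\ge2$ be integers and let $\alpha>0$. Suppose that for every $n$ and every $\mathcal{F}\subseteq\binom{[n]}{k}$ there exists a $k$-partite subfamily $\mathcal{F}'\subseteq\mathcal{F}$ with $|\mathcal{F}'|\ge\alpha|\mathcal{F}|$ such that (1) for every distinct $F_1,F_2\in\mathcal{F}'$ there is a sunflower in $\mathcal{F}'$ with $m$ petals whose kernel is $F_1\cap F_2$; (2) if $m\ge k+1$, then for every $F\in\mathcal{F}'$ the system $I(F,\mathcal{F}')$ is intersection-closed; (3) there exists a set system $\mathcal{I}\subseteq 2^{[k]}\setminus\{[k]\}$ such that $\pi(I(F,\mathcal{F}'))=\mathcal{I}$ for every $F\in\mathcal{F}'$. Then $\alpha\le k!\cdot 2^{ -\binom{k}{\lceil k/2\rceil}}$.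
   Context: $[n]=\{1,\dots,n\}$ and $\binom{[n]}{k}$ is the set of $k$-element subsets of $[n]$. A sunflower with $t$ petals is a collection of distinct sets $F_1,\dots,F_t$ with $F_i\cap F_j=\bigcap_\ell F_\ell$ for all $i\ne j$; this common intersection is the kernel. A set system $\mathcal F'\subseteq\binom{[n]}{k}$ is $k$-partite if there is a partition $[n]=V_1\cup\dots\cup V_k$ such that every member meets every part in exactly one element; $\pi:[n]\to[k]$ is the projection with $a\in V_{\pi(a)}$, $\pi(A)=\{\pi(a):a\in A\}$, and for a set system $\mathcal J$, $\pi(\mathcal J)=\{\pi(J):J\in\mathcal J\}$. For $F\in\mathcal F'$, $I(F,\mathcal F')=\{F\cap F':F'\in\mathcal F'\setminus\{F\}\}$. A set system is intersection-closed if it contains $I\cap I'$ whenever it contains $I,I'$. -}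

module Defs where

open import Data.Nat using (ℕ)
open import Data.Fin using (Fin)
open import Data.Fin.Subset using (Subset; _∩_; ⋂; ∣_∣) renaming (_∈_ to _∈ₛ_)
open import Data.List using (List; tabulate)
open import Data.List.Membership.Propositional using (_∈_)
open import Data.List.Relation.Unary.All using (All)
open import Data.List.Relation.Unary.Unique.Propositional using (Unique)
open import Data.Product using (Σ; ∃; ∃-syntax; _×_)
open import Function using (Injective; _⇔_)
open import Relation.Binary.PropositionalEquality using (_≡_; _≢_)

IsUniformFamily : (n k : ℕ) → List (Subset n) → Set
IsUniformFamily n k 𝓕 = Unique 𝓕 × All (λ A → ∣ A ∣ ≡ k) 𝓕

-- 𝓕' ⊆ 𝓕 (𝓕' also duplicate-free, so its length is its cardinality).
IsSubfamily : {n : ℕ} → List (Subset n) → List (Subset n) → Set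
IsSubfamily 𝓕' 𝓕 = Unique 𝓕' × All (λ A → A ∈ 𝓕) 𝓕'

-- 𝓕' is k-partite w.r.t. the partition [n] = V_1 ∪ … ∪ V_k encoded by the
-- projection π (a ∈ V_{π a}): every member meets every part in exactly one element.
IsKPartiteVia : {n k : ℕ} → (Fin n → Fin k) → List (Subset n) → Set
IsKPartiteVia {n} {k} π 𝓕' =
  All (λ A → (i : Fin k) →
        ∃[ a ] (a ∈ₛ A × π a ≡ i × ((b : Fin n) → b ∈ₛ A → π b ≡ i → b ≡ a))) 𝓕'

kernel : {n t : ℕ} → (Fin t → Subset n) → Subset n
kernel {t = t} S = ⋂ (tabulate S)

IsSunflower : {n t : ℕ} → (Fin t → Subset n) → Set
IsSunflower S = Injective _≡_ _≡_ S × (∀ i j → i ≢ j → S i ∩ S j ≡ kernel S)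

HasSunflowerWithKernel : {n : ℕ} → (t : ℕ) → List (Subset n) → Subset n → Set
HasSunflowerWithKernel {n} t 𝓕' K =
  Σ (Fin t → Subset n) λ S → IsSunflower S × (∀ i → S i ∈ 𝓕') × kernel S ≡ K

InI : {n : ℕ} → Subset n → List (Subset n) → Subset n → Set
InI F 𝓕' X = ∃[ G ] (G ∈ 𝓕' × G ≢ F × X ≡ F ∩ G)

IntersectionClosed : {n : ℕ} → (Subset n → Set) → Set
IntersectionClosed P = ∀ X Y → P X → P Y → P (X ∩ Y)

IsImage : {n k : ℕ} → (Fin n → Fin k) → Subset n → Subset k → Set
IsImage π X J = ∀ j → (j ∈ₛ J ⇔ (∃[ a ] (a ∈ₛ X × π a ≡ j)))

ProjectionOfIEquals : {n k : ℕ} → (Fin n → Fin k) → Subset n → List (Subset n) →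
                      List (Subset k) → Set
ProjectionOfIEquals π F 𝓕' 𝓘 =
  ∀ J → (J ∈ 𝓘 ⇔ (∃[ X ] (InI F 𝓕' X × IsImage π X J)))

{-# OPTIONS --safe #-}

module Submission where

-- Let M = C(k, h) with h = ⌈k/2⌉. For each of the 2^M sets s of h-subsets of [k], take a
-- k-partite component whose edges are the points x ∈ [N]^M and in which two edges differing
-- in the set D of coordinates agree on the intersection, over j ∈ D, of the j-th h-subset if
-- s selects it and of ∅ otherwise. So two edges meet in the j-th h-subset iff s selects it
-- and they differ in the j-th coordinate only. Given a homogeneous 𝓕′ and an edge (s, x) in it,
-- either for every j some other member lies on the line through x in direction j, and then 𝓘
-- determines s up to the bijection [k] → [k] that π induces on that edge; or x is alone on one
-- of its lines. Hence |𝓕′| ≤ k! N^M + M 2^M N^(M-1), against |𝓕| = 2^M N^M, for every N.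

open import Defs
open import Data.Bool using (Bool; true; false; if_then_else_; _∧_)
import Data.Bool.Properties as Bool
open import Data.Nat using (ℕ; zero; suc; _≤_; _<_; _*_; _^_; _+_; _!; ⌈_/2⌉; z≤n; s≤s; s≤s⁻¹)
import Data.Nat.Properties as ℕ
open import Data.Nat.Combinatorics using (_C_; nCn≡1; nCk≡nC[n∸k]; nCk+nC[k+1]≡[n+1]C[k+1])
open import Data.Nat.Combinatorics.Specification using (k>n⇒nCk≡0)
open import Data.Nat.Tactic.RingSolver using (solve-∀)
open import Data.Fin using (Fin; zero; suc; combine; remQuot; join; splitAt; punchIn; punchOut; finToFun; funToFin; _≟_)
import Data.Fin.Properties as Fin
open import Data.Fin.Subset using (Subset; _∩_; ⊤; ⊥; ⁅_⁆; ∣_∣; _⊆_; Nonempty; inside; outside)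
  renaming (_∈_ to _∈ₛ_)
import Data.Fin.Subset.Properties as Subset
open import Data.List using (List; []; _∷_; _++_; length; lookup; map; allFin)
open import Data.List.Properties using (length-map; length-++; length-tabulate)
open import Data.List.Membership.Propositional using (_∈_)
open import Data.List.Membership.Propositional.Properties using (∈-lookup; ∈-map⁻)
import Data.List.Membership.DecPropositional as DecMembership
open import Data.List.Relation.Unary.All as All using (All; []; _∷_)
import Data.List.Relation.Unary.All.Properties as All
open import Data.List.Relation.Unary.AllPairs using ([]; _∷_)
open import Data.List.Relation.Unary.Unique.Propositional using (Unique)
import Data.List.Relation.Unary.Unique.Propositional.Properties as Unique
open import Data.Product using (∃-syntax; _×_; _,_; proj₁; proj₂)
open import Data.Sum using (_⊎_; inj₁; inj₂)
import Data.Vec as Vec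
import Data.Vec.Properties as Vec
open import Function using (_∘_; case_of_; Injective; _⇔_; mk⇔; Equivalence)
open import Relation.Nullary using (¬_; Dec; yes; no; does; contradiction; ¬?)
open import Relation.Nullary.Decidable using (_×-dec_; decidable-stable)
open import Relation.Binary.PropositionalEquality
  using (_≡_; _≢_; refl; sym; trans; cong; cong₂; subst; _≗_; module ≡-Reasoning)

-- Counting through codes, and numbering functions and injections.

≡does : ∀ {P : Set} {b} (P? : Dec P) → (P → b ≡ true) → (b ≡ true → P) → b ≡ does P?
≡does (yes p) to from = to p
≡does (no ¬p) to from = Bool.¬-not (¬p ∘ from)

lookup-injective : {A : Set} {xs : List A} → Unique xs →
  ∀ i j → lookup xs i ≡ lookup xs j → i ≡ j
lookup-injective (_ ∷ _)  zero    zero    _  = refl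
lookup-injective (x∉ ∷ _) zero    (suc j) eq = contradiction eq (All.lookup x∉ (∈-lookup j))
lookup-injective (x∉ ∷ _) (suc i) zero    eq = contradiction (sym eq) (All.lookup x∉ (∈-lookup i))
lookup-injective (_ ∷ u)  (suc i) (suc j) eq = cong suc (lookup-injective u i j eq)

-- Codes form a relation rather than a function because the code of a member is built from its
-- membership proof; injectivity can then be shown without reference to the choice made.
length≤-by-relation : {A : Set} {xs : List A} {n : ℕ} → Unique xs → (R : A → Fin n → Set) →
  (∀ {x} → x ∈ xs → ∃[ r ] R x r) →
  (∀ {x y r} → x ∈ xs → y ∈ xs → R x r → R y r → x ≡ y) →
  length xs ≤ n
length≤-by-relation {xs = xs} u R total inj =
  Fin.injective⇒≤ {f = λ i → proj₁ (total (∈-lookup {xs = xs} i))} λ {i} {j} eq →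
    lookup-injective u i j
      (inj (∈-lookup i) (∈-lookup j) (proj₂ (total (∈-lookup i)))
        (subst (R _) (sym eq) (proj₂ (total (∈-lookup j)))))

funToFin-cong : ∀ {m n} {f g : Fin m → Fin n} → f ≗ g → funToFin f ≡ funToFin g
funToFin-cong {zero}  f≗g = refl
funToFin-cong {suc m} f≗g = cong₂ combine (f≗g zero) (funToFin-cong (f≗g ∘ suc))

funToFin-injective : ∀ {m n} {f g : Fin m → Fin n} → funToFin f ≡ funToFin g → f ≗ g
funToFin-injective {f = f} {g} eq i = trans (sym (Fin.finToFun-funToFin f i))
  (trans (cong (λ c → finToFun c i) eq) (Fin.finToFun-funToFin g i))

finToFun-injective : ∀ {m n} {x y : Fin (n ^ m)} → finToFun {n} {m} x ≗ finToFun y → x ≡ y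
finToFun-injective {m} {n} {x} {y} eq = trans (sym (Fin.funToFin-finToFin {m} {n} x))
  (trans (funToFin-cong eq) (Fin.funToFin-finToFin {m} {n} y))

-- The factorial number system: the leading digit is the image of 0.
decodeInjection : ∀ n → Fin (n !) → Fin n → Fin n
decodeInjection (suc n) c i with remQuot {suc n} (n !) c
decodeInjection (suc n) c zero    | a , _ = a
decodeInjection (suc n) c (suc i) | a , d = punchIn a (decodeInjection n d i)

-- No later argument takes the value `τ zero`, so punching this value out leaves an injection on `n`
-- points, which has a code by recursion.
decodeInjection-surjective : ∀ n (τ : Fin n → Fin n) → Injective _≡_ _≡_ τ →
  ∃[ c ] decodeInjection n c ≗ τ
decodeInjection-surjective zero    τ inj = zero , λ ()
decodeInjection-surjective (suc n) τ inj = combine (τ zero) (proj₁ rec) , eq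
  where
  distinct : ∀ i → τ zero ≢ τ (suc i)
  distinct i p with () ← inj p

  rec : ∃[ c ] decodeInjection n c ≗ (λ i → punchOut (distinct i))
  rec = decodeInjection-surjective n (λ i → punchOut (distinct i))
    λ {i} {j} p → Fin.suc-injective (inj (Fin.punchOut-injective (distinct i) (distinct j) p))

  eq : decodeInjection (suc n) (combine (τ zero) (proj₁ rec)) ≗ τ
  eq i with remQuot {suc n} (n !) (combine (τ zero) (proj₁ rec))
          | Fin.remQuot-combine {suc n} (τ zero) (proj₁ rec)
  eq zero    | _ | refl = refl
  eq (suc i) | _ | refl =
    trans (cong (punchIn (τ zero)) (proj₂ rec i)) (Fin.punchIn-punchOut (distinct i))

-- Cardinalities of subsets and the list of all `h`-subsets.

⊆∧∣∣≡⇒≡ : ∀ {n} {p q : Subset n} → p ⊆ q → ∣ p ∣ ≡ ∣ q ∣ → p ≡ q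
⊆∧∣∣≡⇒≡ {p = Vec.[]}          {Vec.[]}          _   _  = refl
⊆∧∣∣≡⇒≡ {p = outside Vec.∷ p} {outside Vec.∷ q} p⊆q eq =
  cong (outside Vec.∷_) (⊆∧∣∣≡⇒≡ (Subset.drop-∷-⊆ p⊆q) eq)
⊆∧∣∣≡⇒≡ {p = inside Vec.∷ p}  {inside Vec.∷ q}  p⊆q eq =
  cong (inside Vec.∷_) (⊆∧∣∣≡⇒≡ (Subset.drop-∷-⊆ p⊆q) (ℕ.suc-injective eq))
⊆∧∣∣≡⇒≡ {p = outside Vec.∷ p} {inside Vec.∷ q}  p⊆q eq =
  contradiction (subst (_≤ ∣ q ∣) eq (Subset.p⊆q⇒∣p∣≤∣q∣ (Subset.drop-∷-⊆ p⊆q))) ℕ.1+n≰n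
⊆∧∣∣≡⇒≡ {p = inside Vec.∷ p}  {outside Vec.∷ q} p⊆q eq with () ← p⊆q Vec.here

0<∣p∣⇒Nonempty : ∀ {n} {p : Subset n} → 0 < ∣ p ∣ → Nonempty p
0<∣p∣⇒Nonempty {n} {p} 0<∣p∣ with Subset.nonempty? p
... | yes ne    = ne
... | no  empty = contradiction (trans (cong ∣_∣ (Subset.Empty-unique empty)) (Subset.∣⊥∣≡0 n))
                    (ℕ.<⇒≢ 0<∣p∣ ∘ sym)

∣p++q∣≡∣p∣+∣q∣ : ∀ {m n} (p : Subset m) (q : Subset n) → ∣ p Vec.++ q ∣ ≡ ∣ p ∣ + ∣ q ∣
∣p++q∣≡∣p∣+∣q∣ Vec.[]              q = refl
∣p++q∣≡∣p∣+∣q∣ (inside Vec.∷ p)  q = cong suc (∣p++q∣≡∣p∣+∣q∣ p q)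
∣p++q∣≡∣p∣+∣q∣ (outside Vec.∷ p) q = ∣p++q∣≡∣p∣+∣q∣ p q

∣concat-singletons∣ : ∀ {k m} (f : Fin k → Fin m) →
  ∣ Vec.concat (Vec.tabulate (λ i → ⁅ f i ⁆)) ∣ ≡ k
∣concat-singletons∣ {zero}  f = refl
∣concat-singletons∣ {suc k} f = trans (∣p++q∣≡∣p∣+∣q∣ ⁅ f zero ⁆ _)
  (cong₂ _+_ (Subset.∣⁅x⁆∣≡1 (f zero)) (∣concat-singletons∣ (f ∘ suc)))

subsetsOfSize : (n h : ℕ) → List (Subset n)
subsetsOfSize n       zero    = ⊥ ∷ []
subsetsOfSize zero    (suc h) = []
subsetsOfSize (suc n) (suc h) =
  map (inside Vec.∷_) (subsetsOfSize n h) ++ map (outside Vec.∷_) (subsetsOfSize n (suc h))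

-- The recursion behind `subsetsOfSize`, splitting by the first element, is Pascal's rule.
length-subsetsOfSize : (n h : ℕ) → length (subsetsOfSize n h) ≡ n C h
length-subsetsOfSize n zero = sym (trans (nCk≡nC[n∸k] {0} {n} z≤n) (nCn≡1 n))
length-subsetsOfSize zero (suc h) = sym (k>n⇒nCk≡0 {0} {suc h} (s≤s z≤n))
length-subsetsOfSize (suc n) (suc h) = begin
  length (map (inside Vec.∷_) (subsetsOfSize n h) ++ map (outside Vec.∷_) (subsetsOfSize n (suc h)))
    ≡⟨ length-++ (map (inside Vec.∷_) (subsetsOfSize n h)) ⟩
  length (map (inside Vec.∷_) (subsetsOfSize n h)) + length (map (outside Vec.∷_) (subsetsOfSize n (suc h)))
    ≡⟨ cong₂ _+_ (trans (length-map _ (subsetsOfSize n h)) (length-subsetsOfSize n h))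
                 (trans (length-map _ (subsetsOfSize n (suc h))) (length-subsetsOfSize n (suc h))) ⟩
  n C h + n C (suc h)
    ≡⟨ nCk+nC[k+1]≡[n+1]C[k+1] n h ⟩
  suc n C suc h ∎
  where open ≡-Reasoning

subsetsOfSize-card : ∀ n h → All (λ p → ∣ p ∣ ≡ h) (subsetsOfSize n h)
subsetsOfSize-card n       zero    = Subset.∣⊥∣≡0 n ∷ []
subsetsOfSize-card zero    (suc h) = []
subsetsOfSize-card (suc n) (suc h) = All.++⁺
  (All.map⁺ (All.map (cong suc) (subsetsOfSize-card n h)))
  (All.map⁺ (subsetsOfSize-card n (suc h)))

subsetsOfSize-unique : ∀ n h → Unique (subsetsOfSize n h)
subsetsOfSize-unique n       zero    = [] ∷ []
subsetsOfSize-unique zero    (suc h) = []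
subsetsOfSize-unique (suc n) (suc h) = Unique.++⁺
  (Unique.map⁺ Vec.∷-injectiveʳ (subsetsOfSize-unique n h))
  (Unique.map⁺ Vec.∷-injectiveʳ (subsetsOfSize-unique n (suc h)))
  λ where
    (∈ᵢ , ∈ₒ) → case-heads (∈-map⁻ (inside Vec.∷_) ∈ᵢ) (∈-map⁻ (outside Vec.∷_) ∈ₒ)
  where
  case-heads : ∀ {v} → (∃[ p ] (p ∈ subsetsOfSize n h × v ≡ inside Vec.∷ p)) →
    ¬ (∃[ p ] (p ∈ subsetsOfSize n (suc h) × v ≡ outside Vec.∷ p))
  case-heads (_ , _ , refl) (_ , _ , ())

-- Makes the number of layers a successor `suc M′`; a line is then described by `M′` coordinates.
0<length-subsetsOfSize : ∀ {n h} → h ≤ n → 0 < length (subsetsOfSize n h)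
0<length-subsetsOfSize {n}     {zero}  _   = s≤s z≤n
0<length-subsetsOfSize {suc n} {suc h} h≤n
  with subsetsOfSize n h | 0<length-subsetsOfSize {n} {h} (s≤s⁻¹ h≤n)
... | _ ∷ _ | _ = s≤s z≤n

-- The edges, their labels, and where two edges agree.

module Construction
  {k h M′ N′ : ℕ} (layer : Fin (suc M′) → Subset k)
  (layer-injective : Injective _≡_ _≡_ layer) (layer-card : ∀ j → ∣ layer j ∣ ≡ h)
  (0<h : 0 < h) (h<k : h < k)
  where

  M N edges : ℕ
  M = suc M′
  N = suc N′
  edges = 2 ^ M * N ^ M

  -- A number codes a pair: a choice of selected layers and a point of `[N]^M`. Labels are pairs of
  -- the same shape, so they reuse this type.
  Edge : Set
  Edge = Fin edges

  type : Edge → Fin (2 ^ M)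
  type e = proj₁ (remQuot {2 ^ M} (N ^ M) e)

  position : Edge → Fin (N ^ M)
  position e = proj₂ (remQuot {2 ^ M} (N ^ M) e)

  coord : Edge → Fin M → Fin N
  coord e = finToFun (position e)

  Edge-≡ : ∀ {e e′} → type e ≡ type e′ → position e ≡ position e′ → e ≡ e′
  Edge-≡ {e} {e′} p q = trans (sym (Fin.combine-remQuot {2 ^ M} (N ^ M) e))
    (trans (cong₂ combine p q) (Fin.combine-remQuot {2 ^ M} (N ^ M) e′))

  nonzero : Fin 2 → Bool
  nonzero zero    = false
  nonzero (suc _) = true

  nonzero-injective : Injective _≡_ _≡_ nonzero
  nonzero-injective {zero}     {zero}     _ = refl
  nonzero-injective {suc zero} {suc zero} _ = refl

  selects : Fin (2 ^ M) → Fin M → Bool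
  selects s j = nonzero (finToFun s j)

  hides : Fin (2 ^ M) → Fin k → Fin M → Bool
  hides s i j = selects s j ∧ Vec.lookup (layer j) i

  -- The value `zero` is a placeholder. Which coordinates are hidden depends only on the type and on
  -- `i`, so edges of one type have the same coordinates masked at `i`.
  visible : Fin (2 ^ M) → (Fin M → Fin N) → Fin k → Fin M → Fin N
  visible s x i j = if hides s i j then zero else x j

  opaque
    -- The i-th vertex of e records the type of e and those coordinates j of e
    -- that are not hidden by a selected layer set containing i.
    label : Fin k → Edge → Edge
    label i e = combine (type e) (funToFin (visible (type e) (coord e) i))

  -- This will amount to sharing the `i`-th vertex.
  Agree : Edge → Edge → Fin k → Set
  Agree e e′ i = label i e ≡ label i e′

  opaque
    unfolding label

    Agree⇒type≡ : ∀ {e e′ i} → Agree e e′ i → type e ≡ type e′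
    Agree⇒type≡ {e} {e′} = Fin.combine-injectiveˡ (type e) _ (type e′) _

    -- A visible coordinate can be read off the label, so a coordinate that differs must be hidden.
    Agree⇒hides : ∀ {e e′ i} j → coord e j ≢ coord e′ j → Agree e e′ i → hides (type e) i j ≡ true
    Agree⇒hides {e} {e′} {i} j x≢x′ agree = unhidden (type e) (type e′) (Agree⇒type≡ agree)
      (funToFin-injective {f = visible (type e) (coord e) i} {g = visible (type e′) (coord e′) i}
        (Fin.combine-injectiveʳ (type e) _ (type e′) _ agree) j)
      where
      -- The two types become variables here so that their equality can be matched with `refl`.
      unhidden : ∀ s s′ → s ≡ s′ → visible s (coord e) i j ≡ visible s′ (coord e′) i j →
        hides s i j ≡ true
      unhidden s _ refl eq with hides s i j
      ... | true  = refl
      ... | false = contradiction eq x≢x′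

    Agree-intro : ∀ {e e′ i} → type e ≡ type e′ →
      (∀ j → hides (type e) i j ≡ true ⊎ coord e j ≡ coord e′ j) → Agree e e′ i
    Agree-intro {e} {e′} {i} s≡s′ same = cong₂ combine s≡s′ (funToFin-cong
      λ j → pointwise (type e) (type e′) j s≡s′ (same j))
      where
      pointwise : ∀ s s′ j → s ≡ s′ → hides s i j ≡ true ⊎ coord e j ≡ coord e′ j →
        visible s (coord e) i j ≡ visible s′ (coord e′) i j
      pointwise s _ j refl (inj₁ hid) rewrite hid = refl
      pointwise s _ j refl (inj₂ x≡x′) rewrite x≡x′ = refl

  hides⇒selects : ∀ s i j → hides s i j ≡ true → selects s j ≡ true
  hides⇒selects s i j eq with true ← selects s j = refl

  hides⇒∈ : ∀ s i j → hides s i j ≡ true → i ∈ₛ layer j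
  hides⇒∈ s i j eq with true ← selects s j = Vec.lookup⇒[]= i (layer j) eq

  selects∧∈⇒hides : ∀ s i j → selects s j ≡ true → i ∈ₛ layer j → hides s i j ≡ true
  selects∧∈⇒hides s i j sel i∈ = cong₂ _∧_ sel (Vec.[]=⇒lookup i∈)

  -- A common label forces equal types, so the edges differ in some coordinate `j`. That coordinate
  -- is hidden at every index of agreement, which puts all these indices inside one selected layer.
  distinct-agreement : ∀ {e e′ i₀} → e ≢ e′ → Agree e e′ i₀ →
    ∃[ j ] (selects (type e) j ≡ true × (∀ i → Agree e e′ i → i ∈ₛ layer j))
  distinct-agreement {e} {e′} {i₀} e≢e′ agree =
    let j , x≢x′ = Fin.¬∀⟶∃¬ M _ (λ j → coord e j ≟ coord e′ j)
          (λ x≗x′ → e≢e′ (Edge-≡ (Agree⇒type≡ agree) (finToFun-injective x≗x′)))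
    in j , hides⇒selects (type e) i₀ j (Agree⇒hides j x≢x′ agree)
         , λ i → hides⇒∈ (type e) i j ∘ Agree⇒hides j x≢x′

  -- Distinct edges agree only inside a layer, and a layer has `h < k` elements.
  label-separates : ∀ {e e′} → (∀ i → Agree e e′ i) → e ≡ e′
  label-separates {e} {e′} agree = decidable-stable (e ≟ e′) λ e≢e′ →
    let i₀ , _ = 0<∣p∣⇒Nonempty {p = ⊤ {k}} (subst (0 <_) (sym (Subset.∣⊤∣≡n k)) (ℕ.<-trans 0<h h<k))
        j , _ , ⊆j = distinct-agreement e≢e′ (agree i₀)
        k≤h = subst (k ≤_) (layer-card j) (subst (_≤ ∣ layer j ∣) (Subset.∣⊤∣≡n k)
                (Subset.p⊆q⇒∣p∣≤∣q∣ {p = ⊤} λ {i} _ → ⊆j i (agree i)))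
    in ℕ.<⇒≱ h<k k≤h

  -- All agreement lies in some selected layer `j′`. Layers have equal size, so the inclusion of
  -- layer `j` in it is an equality, and `j` is `j′`.
  layer⊆Agree⇒selects : ∀ {e e′} j → e ≢ e′ → (∀ i → i ∈ₛ layer j → Agree e e′ i) →
    selects (type e) j ≡ true
  layer⊆Agree⇒selects {e} {e′} j e≢e′ agree =
    let i₀ , i₀∈ = 0<∣p∣⇒Nonempty (subst (0 <_) (sym (layer-card j)) 0<h)
        j′ , sel , ⊆j′ = distinct-agreement e≢e′ (agree i₀ i₀∈)
        j≡j′ = layer-injective (⊆∧∣∣≡⇒≡ (λ {i} i∈ → ⊆j′ i (agree i i∈))
                 (trans (layer-card j) (sym (layer-card j′))))
    in subst (λ l → selects (type e) l ≡ true) (sym j≡j′) sel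

  -- Axis-parallel lines and agreement along them.

  lines : ℕ
  lines = 2 ^ M * N ^ M′

  opaque
    -- Two edges have the same line in direction j iff they differ at most in the j-th coordinate.
    line : Fin M → Edge → Fin lines
    line j e = combine (type e) (funToFin (coord e ∘ punchIn j))

    line-type≡ : ∀ j {e e′} → line j e ≡ line j e′ → type e ≡ type e′
    line-type≡ j {e} {e′} = Fin.combine-injectiveˡ (type e) _ (type e′) _

    line-coord≡ : ∀ j {e e′} → line j e ≡ line j e′ → ∀ {l} → j ≢ l → coord e l ≡ coord e′ l
    line-coord≡ j {e} {e′} eq {l} j≢l =
      subst (λ l → coord e l ≡ coord e′ l) (Fin.punchIn-punchOut j≢l)
        (funToFin-injective {f = coord e ∘ punchIn j} {g = coord e′ ∘ punchIn j}
          (Fin.combine-injectiveʳ (type e) _ (type e′) _ eq) (punchOut j≢l))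

  -- Distinct edges on this line must differ in coordinate `j`, which is therefore hidden wherever
  -- they agree.
  line-Agree⇒∈ : ∀ j {e e′ i} → line j e ≡ line j e′ → e ≢ e′ → Agree e e′ i → i ∈ₛ layer j
  line-Agree⇒∈ j {e} {e′} {i} eq e≢e′ agree = hides⇒∈ (type e) i j (Agree⇒hides j x≢x′ agree)
    where
    x≢x′ : coord e j ≢ coord e′ j
    x≢x′ x≡x′ = e≢e′ (Edge-≡ (line-type≡ j eq) (finToFun-injective same))
      where
      same : coord e ≗ coord e′
      same l with j ≟ l
      ... | yes refl = x≡x′
      ... | no j≢l   = line-coord≡ j eq j≢l

  -- Selection hides coordinate `j` throughout layer `j`, and the other coordinates coincide. With
  -- the previous lemma, distinct edges on the line agree exactly on layer `j` when it is selected.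
  line-∈⇒Agree : ∀ j {e e′ i} → line j e ≡ line j e′ → selects (type e) j ≡ true →
    i ∈ₛ layer j → Agree e e′ i
  line-∈⇒Agree j {e} {e′} {i} eq sel i∈ = Agree-intro (line-type≡ j eq) same
    where
    same : ∀ l → hides (type e) i l ≡ true ⊎ coord e l ≡ coord e′ l
    same l with j ≟ l
    ... | yes refl = inj₁ (selects∧∈⇒hides (type e) i j sel i∈)
    ... | no j≢l   = inj₂ (line-coord≡ j eq j≢l)

  -- Edges as `k`-sets, with one vertex in each of `k` blocks of size `edges`.

  vertex : Edge → Fin k → Fin (k * edges)
  vertex e i = combine i (label i e)

  opaque
    edge : Edge → Subset (k * edges)
    edge e = Vec.concat (Vec.tabulate (λ i → ⁅ label i e ⁆))

    lookup-edge : ∀ e i w → Vec.lookup (edge e) (combine i w) ≡ Vec.lookup ⁅ label i e ⁆ w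
    lookup-edge e i w = trans (Vec.lookup-concat (Vec.tabulate (λ i → ⁅ label i e ⁆)) i w)
      (cong (λ p → Vec.lookup p w) (Vec.lookup∘tabulate (λ i → ⁅ label i e ⁆) i))

    ∣edge∣≡k : ∀ e → ∣ edge e ∣ ≡ k
    ∣edge∣≡k e = ∣concat-singletons∣ (λ i → label i e)

  vertex∈edge : ∀ e i → vertex e i ∈ₛ edge e
  vertex∈edge e i = Vec.lookup⇒[]= _ (edge e)
    (trans (lookup-edge e i (label i e)) (Vec.[]=⇒lookup (Subset.x∈⁅x⁆ (label i e))))

  combine∈edge⇒ : ∀ e i w → combine i w ∈ₛ edge e → w ≡ label i e
  combine∈edge⇒ e i w ∈e = Subset.x∈⁅y⁆⇒x≡y (label i e)
    (Vec.lookup⇒[]= w ⁅ label i e ⁆ (trans (sym (lookup-edge e i w)) (Vec.[]=⇒lookup ∈e)))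

  ∈edge⇒vertex : ∀ e {a} → a ∈ₛ edge e → ∃[ i ] a ≡ vertex e i
  ∈edge⇒vertex e {a} a∈ with i , w , refl ← Fin.combine-surjective {k} {edges} a =
    i , cong (combine i) (combine∈edge⇒ e i w a∈)

  vertex∈edge⇒Agree : ∀ e e′ i → vertex e i ∈ₛ edge e′ → Agree e e′ i
  vertex∈edge⇒Agree e e′ i = combine∈edge⇒ e′ i (label i e)

  Agree⇒vertex∈edge : ∀ e e′ i → Agree e e′ i → vertex e i ∈ₛ edge e′
  Agree⇒vertex∈edge e e′ i agree =
    subst (λ w → combine i w ∈ₛ edge e′) (sym agree) (vertex∈edge e′ i)

  edge-injective : Injective _≡_ _≡_ edge
  edge-injective {e} {e′} eq = label-separates λ i →
    vertex∈edge⇒Agree e e′ i (subst (vertex e i ∈ₛ_) eq (vertex∈edge e i))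

  family : List (Subset (k * edges))
  family = map edge (allFin edges)

  family-uniform : IsUniformFamily (k * edges) k family
  family-uniform = Unique.map⁺ edge-injective (Unique.allFin⁺ edges) ,
    All.map⁺ (All.tabulate λ {e} _ → ∣edge∣≡k e)

  length-family : length family ≡ edges
  length-family = trans (length-map edge (allFin edges)) (length-tabulate {n = edges} (λ i → i))

  -- What the projected intersections reveal about the type of a member.

  module Homogeneous
    (𝓕′ : List (Subset (k * edges))) (𝓕′-sub : IsSubfamily 𝓕′ family)
    (π : Fin (k * edges) → Fin k) (partite : IsKPartiteVia π 𝓕′)
    (𝓘 : List (Subset k)) (homogeneous : ∀ F → F ∈ 𝓕′ → ProjectionOfIEquals π F 𝓕′ 𝓘)
    where

    ∈𝓕′⇒edge : ∀ {F} → F ∈ 𝓕′ → ∃[ e ] F ≡ edge e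
    ∈𝓕′⇒edge F∈ =
      let e , _ , eq = ∈-map⁻ edge (All.lookup (proj₂ 𝓕′-sub) F∈) in e , eq

    _∈𝓕′? : ∀ e → Dec (edge e ∈ 𝓕′)
    e ∈𝓕′? = DecMembership._∈?_ (Vec.≡-dec Bool._≟_) (edge e) 𝓕′

    _∈𝓘? : ∀ J → Dec (J ∈ 𝓘)
    J ∈𝓘? = DecMembership._∈?_ (Vec.≡-dec Bool._≟_) J 𝓘

    -- The preimage of layer `j` under `τ`: layer `j` written in colours instead of block indices.
    relabelled : (Fin k → Fin k) → Fin M → Subset k
    relabelled τ j = Vec.tabulate (Vec.lookup (layer j) ∘ τ)

    ∈relabelled⇔ : ∀ τ j c → c ∈ₛ relabelled τ j ⇔ τ c ∈ₛ layer j
    ∈relabelled⇔ τ j c = mk⇔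
      (λ c∈ → Vec.lookup⇒[]= (τ c) (layer j) (trans (sym (Vec.lookup∘tabulate _ c)) (Vec.[]=⇒lookup c∈)))
      (λ ∈l → Vec.lookup⇒[]= c (relabelled τ j) (trans (Vec.lookup∘tabulate _ c) (Vec.[]=⇒lookup ∈l)))

    module Member (e : Edge) (e∈ : edge e ∈ 𝓕′) where

      colour-vertex : ∀ c → ∃[ i ] (π (vertex e i) ≡ c × (∀ i′ → π (vertex e i′) ≡ c → i′ ≡ i))
      colour-vertex c with a , a∈ , πa≡c , unique ← All.lookup partite e∈ c
        with i , refl ← ∈edge⇒vertex e a∈ =
        i , πa≡c , λ i′ eq → Fin.combine-injectiveˡ i′ (label i′ e) i (label i e)
          (unique (vertex e i′) (vertex∈edge e i′) eq)

      -- The inverse of the colouring that sends `i` to `π (vertex e i)`. The parts given by `π`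
      -- need not be the blocks, so this bijection may vary with the edge.
      τ : Fin k → Fin k
      τ c = proj₁ (colour-vertex c)

      π-vertex-τ : ∀ c → π (vertex e (τ c)) ≡ c
      π-vertex-τ c = proj₁ (proj₂ (colour-vertex c))

      π-vertex⇒τ : ∀ {c} i → π (vertex e i) ≡ c → i ≡ τ c
      π-vertex⇒τ {c} = proj₂ (proj₂ (colour-vertex c))

      τ-injective : Injective _≡_ _≡_ τ
      τ-injective {c} {c′} eq =
        trans (sym (π-vertex-τ c)) (trans (cong (π ∘ vertex e) eq) (π-vertex-τ c′))

      τ-surjective : ∀ i → ∃[ c ] τ c ≡ i
      τ-surjective i = π (vertex e i) , sym (π-vertex⇒τ i refl)

      -- The only vertex of `e` with colour `c` is the one in block `τ c`, so this colour appears in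
      -- the intersection exactly when that vertex is shared.
      coloured⇔Agree : ∀ e′ c → (∃[ a ] (a ∈ₛ edge e ∩ edge e′ × π a ≡ c)) ⇔ Agree e e′ (τ c)
      coloured⇔Agree e′ c = mk⇔ to from
        where
        to : (∃[ a ] (a ∈ₛ edge e ∩ edge e′ × π a ≡ c)) → Agree e e′ (τ c)
        to (a , a∈ , πa≡c) with a∈e , a∈e′ ← Subset.x∈p∩q⁻ (edge e) (edge e′) a∈
          with i , refl ← ∈edge⇒vertex e a∈e =
          subst (Agree e e′) (π-vertex⇒τ i πa≡c) (vertex∈edge⇒Agree e e′ i a∈e′)

        from : Agree e e′ (τ c) → ∃[ a ] (a ∈ₛ edge e ∩ edge e′ × π a ≡ c)
        from agree = vertex e (τ c) ,
          Subset.x∈p∩q⁺ (vertex∈edge e (τ c) , Agree⇒vertex∈edge e e′ (τ c) agree) , π-vertex-τ c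

      -- Homogeneity yields another member whose intersection with `edge e` has precisely these
      -- colours. Translated back by `τ`, the two agree on all of layer `j`, which only a selected
      -- layer permits.
      relabelled∈𝓘⇒selects : ∀ j → relabelled τ j ∈ 𝓘 → selects (type e) j ≡ true
      relabelled∈𝓘⇒selects j J∈
        with X , (G , G∈ , G≢ , refl) , image ← Equivalence.to (homogeneous (edge e) e∈ _) J∈
        with e′ , refl ← ∈𝓕′⇒edge G∈ =
        layer⊆Agree⇒selects j (G≢ ∘ cong edge ∘ sym) agree
        where
        agree : ∀ i → i ∈ₛ layer j → Agree e e′ i
        agree i i∈ with c , refl ← τ-surjective i =
          Equivalence.to (coloured⇔Agree e′ c)
            (Equivalence.to (image c) (Equivalence.from (∈relabelled⇔ τ j c) i∈))

      -- The second member on the line is the witness: its intersection with `edge e` is exactly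
      -- layer `j`, up to colours.
      selects⇒relabelled∈𝓘 : ∀ j e′ → edge e′ ∈ 𝓕′ → line j e ≡ line j e′ → e ≢ e′ →
        selects (type e) j ≡ true → relabelled τ j ∈ 𝓘
      selects⇒relabelled∈𝓘 j e′ e′∈ eq e≢e′ sel = Equivalence.from (homogeneous (edge e) e∈ _)
        (edge e ∩ edge e′ , (edge e′ , e′∈ , e≢e′ ∘ sym ∘ edge-injective , refl) ,
          λ c → mk⇔
            (Equivalence.from (coloured⇔Agree e′ c) ∘ line-∈⇒Agree j eq sel
              ∘ Equivalence.to (∈relabelled⇔ τ j c))
            (Equivalence.from (∈relabelled⇔ τ j c) ∘ line-Agree⇒∈ j eq e≢e′
              ∘ Equivalence.to (coloured⇔Agree e′ c)))

    -- Counting the members by recovered types and isolated points.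

    Recovers : Fin (k !) → Edge → Set
    Recovers c e = ∀ j → selects (type e) j ≡ does (relabelled (decodeInjection k c) j ∈𝓘?)

    Isolated : Fin M → Edge → Set
    Isolated j e = ∀ e′ → edge e′ ∈ 𝓕′ → line j e ≡ line j e′ → e ≡ e′

    -- The positive form of not being isolated: it supplies the second member on the line, and it is
    -- decidable.
    Crowded : Edge → Fin M → Set
    Crowded e j = ∃[ e′ ] (edge e′ ∈ 𝓕′ × line j e ≡ line j e′ × e ≢ e′)

    crowded? : ∀ e j → Dec (Crowded e j)
    crowded? e j = Fin.any? λ e′ → (e′ ∈𝓕′?) ×-dec (line j e ≟ line j e′) ×-dec ¬? (e ≟ e′)

    crowded⇒recovers : ∀ e (e∈ : edge e ∈ 𝓕′) → (∀ j → Crowded e j) →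
      ∀ c → decodeInjection k c ≗ Member.τ e e∈ → Recovers c e
    crowded⇒recovers e e∈ crowded c c≗τ j = ≡does (relabelled (decodeInjection k c) j ∈𝓘?)
      (λ J∈ → relabelled∈𝓘⇒selects j (subst (_∈ 𝓘) relabelled-c J∈))
      (λ sel → let e′ , e′∈ , eq , e≢e′ = crowded j in
        subst (_∈ 𝓘) (sym relabelled-c) (selects⇒relabelled∈𝓘 j e′ e′∈ eq e≢e′ sel))
      where
      open Member e e∈

      relabelled-c : relabelled (decodeInjection k c) j ≡ relabelled τ j
      relabelled-c = Vec.tabulate-cong (cong (Vec.lookup (layer j)) ∘ c≗τ)

    ¬crowded⇒isolated : ∀ {e j} → ¬ Crowded e j → Isolated j e
    ¬crowded⇒isolated {e} ¬crowded e′ e′∈ eq =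
      decidable-stable (e ≟ e′) λ e≢e′ → ¬crowded (e′ , e′∈ , eq , e≢e′)

    recovers-or-isolated : ∀ e → edge e ∈ 𝓕′ → (∃[ c ] Recovers c e) ⊎ (∃[ j ] Isolated j e)
    recovers-or-isolated e e∈ = case Fin.all? (crowded? e) of λ where
      (yes crowded) →
        let open Member e e∈
            c , c≗τ = decodeInjection-surjective k τ τ-injective
        in inj₁ (c , crowded⇒recovers e e∈ crowded c c≗τ)
      (no ¬crowded) → let j , ¬crowdedⱼ = Fin.¬∀⟶∃¬ M (Crowded e) (crowded? e) ¬crowded in
        inj₂ (j , ¬crowded⇒isolated ¬crowdedⱼ)

    -- The first term counts pairs of a permutation and a position, the second counts pairs of a
    -- direction and a line.
    bound : ℕ
    bound = k ! * N ^ M + M * lines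

    Code : Edge → Fin (k ! * N ^ M) ⊎ Fin (M * lines) → Set
    Code e (inj₁ r) = ∃[ c ] (r ≡ combine c (position e) × Recovers c e)
    Code e (inj₂ r) = ∃[ j ] (r ≡ combine j (line j e) × Isolated j e)

    encode : ∀ e → edge e ∈ 𝓕′ → ∃[ r ] Code e r
    encode e e∈ with recovers-or-isolated e e∈
    ... | inj₁ (c , rec) = inj₁ (combine c (position e)) , c , refl , rec
    ... | inj₂ (j , iso) = inj₂ (combine j (line j e)) , j , refl , iso

    -- In the first case the code gives the position and `c`; the latter, with `𝓘` fixed, determines
    -- every selected layer and hence the type. In the second case both members lie on one line,
    -- where `e` is alone.
    Code-injective : ∀ {e e′} r → edge e′ ∈ 𝓕′ → Code e r → Code e′ r → e ≡ e′
    Code-injective {e} {e′} (inj₁ _) _ (c , refl , rec) (c′ , eq , rec′)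
      with refl , pos ← Fin.combine-injective c (position e) c′ (position e′) eq =
      Edge-≡ (finToFun-injective (λ j → nonzero-injective (trans (rec j) (sym (rec′ j))))) pos
    Code-injective {e} {e′} (inj₂ _) e′∈ (j , refl , iso) (j′ , eq , _)
      with refl , line≡ ← Fin.combine-injective j (line j e) j′ (line j′ e′) eq = iso e′ e′∈ line≡

    length-bound : length 𝓕′ ≤ bound
    length-bound = length≤-by-relation (proj₁ 𝓕′-sub)
      (λ F r → ∃[ e ] (F ≡ edge e × Code e (splitAt (k ! * N ^ M) r)))
      total injective
      where
      total : ∀ {F} → F ∈ 𝓕′ → ∃[ r ] ∃[ e ] (F ≡ edge e × Code e (splitAt (k ! * N ^ M) r))
      total F∈ with e , refl ← ∈𝓕′⇒edge F∈ with r , code ← encode e F∈ =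
        join (k ! * N ^ M) (M * lines) r , e , refl ,
          subst (Code e) (sym (Fin.splitAt-join (k ! * N ^ M) (M * lines) r)) code

      injective : ∀ {F G r} → F ∈ 𝓕′ → G ∈ 𝓕′ →
        ∃[ e ] (F ≡ edge e × Code e (splitAt (k ! * N ^ M) r)) →
        ∃[ e ] (G ≡ edge e × Code e (splitAt (k ! * N ^ M) r)) → F ≡ G
      injective {r = r} _ G∈ (e , refl , code) (e′ , refl , code′) =
        cong edge (Code-injective (splitAt (k ! * N ^ M) r) G∈ code code′)

-- Choosing `N` large, and the final inequality.

-- The lower-order term M·2^M·N^M′ is absorbed by taking N > q·M·2^M.
large-N : ∀ p q A f M′ → let M = suc M′ ; N = suc (q * M * A) in
  p * (A * N ^ M) ≤ q * (f * N ^ M + M * (A * N ^ M′)) → p * A ≤ f * q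
large-N p q A f M′ le = ℕ.≮⇒≥ λ fq<pA → ℕ.1+n≰n (ℕ.+-cancelˡ-≤ (f * q * N) N (q * M * A)
  (begin
    f * q * N + N          ≡⟨ ℕ.+-comm (f * q * N) N ⟩
    suc (f * q) * N        ≤⟨ ℕ.*-monoˡ-≤ N fq<pA ⟩
    p * A * N              ≤⟨ ℕ.*-cancelʳ-≤ (p * A * N) (f * q * N + q * M * A) P {{ℕ.m^n≢0 N M′}}
                              (begin
                                p * A * N * P ≡⟨ left p A N P ⟩
                                p * (A * (N * P)) ≤⟨ le ⟩
                                q * (f * (N * P) + M * (A * P)) ≡⟨ right q f N P M A ⟩
                                (f * q * N + q * M * A) * P ∎) ⟩
    f * q * N + q * M * A  ∎))
  where
  open ℕ.≤-Reasoning
  M N P : ℕ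
  M = suc M′
  N = suc (q * M * A)
  P = N ^ M′

  left : ∀ p A N P → p * A * N * P ≡ p * (A * (N * P))
  left = solve-∀

  right : ∀ q f N P M A → q * (f * (N * P) + M * (A * P)) ≡ (f * q * N + q * M * A) * P
  right = solve-∀

theorem1p6 : (k m p q : ℕ) → 3 ≤ k → 2 ≤ m → 1 ≤ p → 1 ≤ q →
    ((n : ℕ) (𝓕 : List (Subset n)) → IsUniformFamily n k 𝓕 →
    ∃[ 𝓕' ] (IsSubfamily 𝓕' 𝓕 × p * length 𝓕 ≤ q * length 𝓕' ×
    ∃[ π ] (IsKPartiteVia {n} {k} π 𝓕' ×
    ((F₁ F₂ : Subset n) → F₁ ∈ 𝓕' → F₂ ∈ 𝓕' → F₁ ≢ F₂ →
    HasSunflowerWithKernel m 𝓕' (F₁ ∩ F₂)) ×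
    (k + 1 ≤ m → (F : Subset n) → F ∈ 𝓕' → IntersectionClosed (InI F 𝓕')) ×
    ∃[ 𝓘 ] (All (λ J → J ≢ ⊤) 𝓘 ×
    ((F : Subset n) → F ∈ 𝓕' → ProjectionOfIEquals π F 𝓕' 𝓘))))) →
    p * 2 ^ (k C ⌈ k /2⌉) ≤ k ! * q
theorem1p6 k@(suc (suc n)) _ p q (s≤s (s≤s _)) _ _ _ hyp = main (k C h) (length-subsetsOfSize k h)
  where
  h = ⌈ k /2⌉

  h<k : h < k
  h<k = ℕ.⌈n/2⌉<n n

  0<h : 0 < h
  0<h = s≤s z≤n

  -- The binomial coefficient is generalised to `M` so that it can be matched as `suc M′`.
  main : ∀ M → length (subsetsOfSize k h) ≡ M → p * 2 ^ M ≤ k ! * q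
  main zero len = contradiction (subst (0 <_) len (0<length-subsetsOfSize (ℕ.<⇒≤ h<k))) ℕ.n≮0
  main (suc M′) len = large-N p q (2 ^ suc M′) (k !) M′ bounded
    where
    position : Fin (suc M′) → Fin (length (subsetsOfSize k h))
    position = subst Fin (sym len)

    position-injective : Injective _≡_ _≡_ position
    position-injective = subst-injective (sym len)
      where
      subst-injective : ∀ {a b} (eq : a ≡ b) → Injective _≡_ _≡_ (subst Fin eq)
      subst-injective refl i≡j = i≡j

    -- The explicit product is `N′`; the side length `N` is one more, which is the value that
    -- `large-N` requires.
    open Construction {k} {h} {M′} {q * suc M′ * 2 ^ suc M′} (lookup (subsetsOfSize k h) ∘ position)
      (position-injective ∘ lookup-injective (subsetsOfSize-unique k h) _ _)
      (λ j → All.lookup (subsetsOfSize-card k h) (∈-lookup (position j)))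
      0<h h<k

    bounded : p * edges ≤ q * (k ! * N ^ M + M * lines)
    bounded =
      let 𝓕′ , sub , dense , π , partite , _ , _ , 𝓘 , _ , homogeneous =
            hyp (k * edges) family family-uniform
      in ℕ.≤-trans (subst (λ l → p * l ≤ q * length 𝓕′) length-family dense)
           (ℕ.*-monoʳ-≤ q (Homogeneous.length-bound 𝓕′ sub π partite 𝓘 homogeneous))
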